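{- For every integer $m\ge1$ the following polynomial identities in two variables $x,y$ over $\mathbb{Q}$ hold: $$\sum_{k=0}^{2m-1}\left(-\frac12\right)^{k+1}\binom{2m+1}{k}\left(x^{2m+1-k}+y^{2m+1-k}\right)(x+y)^k=\frac{m}{2^{2m}}(x+y)^{2m+1},$$ $$\sum_{k=0}^{2m-2}(-1)^k2^{2m-k-1}\binom{2m}{k}\left(x^{2m-k}+y^{2m-k}\right)(x+y)^k=(2m-1)(x+y)^{2m}+(x-y)^{2m}.$$ -}

module Defs where

open import Algebra.Bundles.Raw using (RawRing)
import Algebra.Definitions.RawSemiring as RawSemiringDefs
open import Data.Fin.Base using (toℕ)
open import Data.Integer.Base using (+_)
open import Data.List.Base using (List; []; _∷_; map)
open import Data.Nat.Base as ℕ using (ℕ; zero; suc)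
open import Data.Rational.Base as ℚ using (ℚ; 0ℚ; 1ℚ)
open import Level using (0ℓ)

-- Univariate polynomials over R as coefficient lists, constant term first.
-- Trailing zeros are allowed, so equality compares all coefficients.
module Univariate {c ℓ} (R : RawRing c ℓ) where

  private module R = RawRing R

  Poly : Set c
  Poly = List R.Carrier

  coeff : Poly → ℕ → R.Carrier
  coeff []      _       = R.0#
  coeff (a ∷ p) zero    = a
  coeff (a ∷ p) (suc n) = coeff p n

  infix  4 _≈ᴾ_
  infixl 6 _+ᴾ_
  infixl 7 _*ᴾ_

  _≈ᴾ_ : Poly → Poly → Set ℓ
  p ≈ᴾ q = ∀ n → coeff p n R.≈ coeff q n

  _+ᴾ_ : Poly → Poly → Poly
  []      +ᴾ q       = q
  (a ∷ p) +ᴾ []      = a ∷ p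
  (a ∷ p) +ᴾ (b ∷ q) = (a R.+ b) ∷ (p +ᴾ q)

  -- (a + t p) q = a q + t (p q), where t is the indeterminate.
  _*ᴾ_ : Poly → Poly → Poly
  []      *ᴾ q = []
  (a ∷ p) *ᴾ q = map (a R.*_) q +ᴾ (R.0# ∷ (p *ᴾ q))

  constant : R.Carrier → Poly
  constant a = a ∷ []

  indeterminate : Poly
  indeterminate = R.0# ∷ R.1# ∷ []

  rawRing : RawRing c ℓ
  rawRing = record
    { Carrier = Poly
    ; _≈_     = _≈ᴾ_
    ; _+_     = _+ᴾ_
    ; _*_     = _*ᴾ_
    ; -_      = map R.-_
    ; 0#      = []
    ; 1#      = constant R.1#
    }

private
  module ℚ[x]    = Univariate ℚ.+-*-rawRing
  module ℚ[x][y] = Univariate ℚ[x].rawRing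

ℚ[x,y]-rawRing : RawRing 0ℓ 0ℓ
ℚ[x,y]-rawRing = ℚ[x][y].rawRing

open RawRing ℚ[x,y]-rawRing public
  using (_≈_; _+_; _*_; -_) renaming (Carrier to ℚ[x,y])

open RawSemiringDefs (RawRing.rawSemiring ℚ[x,y]-rawRing) public
  using (_^_; sum)

open RawSemiringDefs ℚ.+-*-rawSemiring public
  using () renaming (_^_ to _^ℚ_)

infixl 6 _-_

_-_ : ℚ[x,y] → ℚ[x,y] → ℚ[x,y]
p - q = p + (- q)

x y : ℚ[x,y]
x = ℚ[x][y].constant ℚ[x].indeterminate
y = ℚ[x][y].indeterminate

const : ℚ → ℚ[x,y]
const a = ℚ[x][y].constant (ℚ[x].constant a)

fromℕ : ℕ → ℚ
fromℕ n = + n ℚ./ 1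

-- The upper limit n is included.
∑-upTo : ℕ → (ℕ → ℚ[x,y]) → ℚ[x,y]
∑-upTo n f = sum {suc n} (λ i → f (toℕ i))

infix 5 ∑-upTo
syntax ∑-upTo n (λ k → p) = ∑[ k ≤ n ] p

{-# OPTIONS --safe #-}
module Submission where

-- Write s = x + y, and let n = 2m or 2m + 1.  By the binomial theorem the sum over
-- the full range 0 ≤ k ≤ n of C(n,k) bᵏ aⁿ⁻ᵏ (xⁿ⁻ᵏ + yⁿ⁻ᵏ) sᵏ is
-- (a x + b s)ⁿ + (a y + b s)ⁿ, and for a = -2b this equals bⁿ ((y - x)ⁿ + (x - y)ⁿ).
-- It vanishes for odd n and doubles for even n.  The two terms k = n - 1 and k = n, which
-- the identities omit, are multiples of sⁿ because x + y = s; together they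
-- contribute -2 (n - 1) bⁿ sⁿ.  The first identity is a = 1, b = -1/2, scaled by -1/2; the
-- second is a = 2, b = -1, scaled by 1/2.

open import Algebra.Bundles using (CommutativeRing; Semiring)
open import Algebra.Morphism.Structures using (module SemiringMorphisms)
open import Data.Fin.Base using (toℕ)
import Data.Fin.Properties as Fin
open import Data.Integer.Base as ℤ using (+_)
import Data.Integer.Properties as ℤ
open import Data.List.Base using ([]; _∷_; map)
open import Data.Nat.Base as ℕ using (ℕ; zero; suc; _∸_; _≤_; _≥_; z≤n; s≤s; NonZero)
open import Data.Nat.Combinatorics using (_C_; nCk≡nC[n∸k]; nC1≡n; nCn≡1)
import Data.Nat.Properties as ℕ
open import Data.Nat.Properties using (m^n≢0)
open import Data.Product.Base using (_,_)
open import Data.Rational.Base as ℚ using (ℚ; 0ℚ; 1ℚ; ½; -½; toℚᵘ)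
import Data.Rational.Properties as ℚ
open import Data.Rational.Solver using (module +-*-Solver)
import Data.Rational.Unnormalised.Base as ℚᵘ
import Data.Rational.Unnormalised.Properties as ℚᵘ
open import Defs using (fromℕ; _^ℚ_; module Univariate)
open import Function.Base using (_∘_)
open import Relation.Binary.Bundles using (Setoid)
open import Relation.Binary.PropositionalEquality as ≡ using (_≡_)
import Relation.Binary.Reasoning.Setoid as SetoidReasoning

-- The ring of univariate polynomials over a commutative ring.

module PolynomialRing {c ℓ} (R : CommutativeRing c ℓ) where

  open CommutativeRing R hiding (_-_)
  open Univariate rawRing
  open import Algebra.Properties.Ring ring using (-0#≈0#)

  -- _≈ᴾ_ unfolds to a function type, from which Agda cannot recover the two
  -- polynomials; wrapping it in a record makes them inferable.
  record _≋_ (p q : Poly) : Set ℓ where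
    constructor coefficientwise
    field at : p ≈ᴾ q

  open _≋_

  infix 4 _≋_

  ≋-setoid : Setoid c ℓ
  ≋-setoid = record
    { Carrier       = Poly
    ; _≈_           = _≋_
    ; isEquivalence = record
      { refl  = coefficientwise λ _ → refl
      ; sym   = λ p≋q → coefficientwise λ n → sym (at p≋q n)
      ; trans = λ p≋q q≋r → coefficientwise λ n → trans (at p≋q n) (at q≋r n)
      }
    }

  open Setoid ≋-setoid using () renaming (refl to ≋-refl; sym to ≋-sym; trans to ≋-trans)
  open SetoidReasoning ≋-setoid

  -- The recursion of `_*ᴾ_` reads `(a ∷ p) *ᴾ q = scale a q +ᴾ shift (p *ᴾ q)`, so laws of
  -- multiplication reduce to laws of `scale` and `shift`.
  scale : Carrier → Poly → Poly
  scale a = map (a *_)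

  shift : Poly → Poly
  shift p = 0# ∷ p

  -- Equal polynomials may have lists of different lengths, so congruences do not follow by
  -- simultaneous induction on the lists; formulas for coefficients carry them over from `R`.
  coeff-+ : ∀ p q n → coeff (p +ᴾ q) n ≈ coeff p n + coeff q n
  coeff-+ []      q       n       = sym (+-identityˡ _)
  coeff-+ (a ∷ p) []      n       = sym (+-identityʳ _)
  coeff-+ (a ∷ p) (b ∷ q) zero    = refl
  coeff-+ (a ∷ p) (b ∷ q) (suc n) = coeff-+ p q n

  coeff-scale : ∀ a p n → coeff (scale a p) n ≈ a * coeff p n
  coeff-scale a []      n       = sym (zeroʳ a)
  coeff-scale a (b ∷ p) zero    = refl
  coeff-scale a (b ∷ p) (suc n) = coeff-scale a p n

  coeff-neg : ∀ p n → coeff (map -_ p) n ≈ - coeff p n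
  coeff-neg []      n       = sym -0#≈0#
  coeff-neg (a ∷ p) zero    = refl
  coeff-neg (a ∷ p) (suc n) = coeff-neg p n

  ∷-cong : ∀ {a b p q} → a ≈ b → p ≋ q → a ∷ p ≋ b ∷ q
  ∷-cong a≈b p≋q = coefficientwise λ { zero → a≈b ; (suc n) → at p≋q n }

  shift-cong : ∀ {p q} → p ≋ q → shift p ≋ shift q
  shift-cong = ∷-cong refl

  shift-[] : shift [] ≋ []
  shift-[] = coefficientwise λ { zero → refl ; (suc n) → refl }

  +ᴾ-cong : ∀ {p p′ q q′} → p ≋ p′ → q ≋ q′ → p +ᴾ q ≋ p′ +ᴾ q′
  +ᴾ-cong {p} {p′} {q} {q′} p≋p′ q≋q′ = coefficientwise λ n →
    trans (coeff-+ p q n)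
      (trans (+-cong (at p≋p′ n) (at q≋q′ n)) (sym (coeff-+ p′ q′ n)))

  +ᴾ-congˡ : ∀ p {q q′} → q ≋ q′ → p +ᴾ q ≋ p +ᴾ q′
  +ᴾ-congˡ p = +ᴾ-cong (≋-refl {p})

  +ᴾ-identityʳ : ∀ p → p +ᴾ [] ≋ p
  +ᴾ-identityʳ []      = ≋-refl
  +ᴾ-identityʳ (a ∷ p) = ≋-refl

  +ᴾ-assoc : ∀ p q r → (p +ᴾ q) +ᴾ r ≋ p +ᴾ (q +ᴾ r)
  +ᴾ-assoc []      q       r       = ≋-refl
  +ᴾ-assoc (a ∷ p) []      r       = ≋-refl
  +ᴾ-assoc (a ∷ p) (b ∷ q) []      = ≋-refl
  +ᴾ-assoc (a ∷ p) (b ∷ q) (d ∷ r) = ∷-cong (+-assoc a b d) (+ᴾ-assoc p q r)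

  +ᴾ-comm : ∀ p q → p +ᴾ q ≋ q +ᴾ p
  +ᴾ-comm []      q       = ≋-sym (+ᴾ-identityʳ q)
  +ᴾ-comm (a ∷ p) []      = ≋-refl
  +ᴾ-comm (a ∷ p) (b ∷ q) = ∷-cong (+-comm a b) (+ᴾ-comm p q)

  +ᴾ-interchange : ∀ p q r s → (p +ᴾ q) +ᴾ (r +ᴾ s) ≋ (p +ᴾ r) +ᴾ (q +ᴾ s)
  +ᴾ-interchange p q r s = begin
    (p +ᴾ q) +ᴾ (r +ᴾ s) ≈⟨ +ᴾ-assoc p q _ ⟩
    p +ᴾ (q +ᴾ (r +ᴾ s)) ≈⟨ +ᴾ-congˡ p (+ᴾ-assoc q r s) ⟨
    p +ᴾ ((q +ᴾ r) +ᴾ s) ≈⟨ +ᴾ-congˡ p (+ᴾ-cong (+ᴾ-comm q r) (≋-refl {s})) ⟩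
    p +ᴾ ((r +ᴾ q) +ᴾ s) ≈⟨ +ᴾ-congˡ p (+ᴾ-assoc r q s) ⟩
    p +ᴾ (r +ᴾ (q +ᴾ s)) ≈⟨ +ᴾ-assoc p r _ ⟨
    (p +ᴾ r) +ᴾ (q +ᴾ s) ∎

  neg-cong : ∀ {p q} → p ≋ q → map -_ p ≋ map -_ q
  neg-cong {p} {q} p≋q = coefficientwise λ n →
    trans (coeff-neg p n) (trans (-‿cong (at p≋q n)) (sym (coeff-neg q n)))

  +ᴾ-inverseˡ : ∀ p → map -_ p +ᴾ p ≋ []
  +ᴾ-inverseˡ []      = ≋-refl
  +ᴾ-inverseˡ (a ∷ p) = ≋-trans (∷-cong (-‿inverseˡ a) (+ᴾ-inverseˡ p)) shift-[]

  scale-cong : ∀ {a b p q} → a ≈ b → p ≋ q → scale a p ≋ scale b q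
  scale-cong {a} {b} {p} {q} a≈b p≋q = coefficientwise λ n →
    trans (coeff-scale a p n) (trans (*-cong a≈b (at p≋q n)) (sym (coeff-scale b q n)))

  scale-0 : ∀ p → scale 0# p ≋ []
  scale-0 p = coefficientwise λ n → trans (coeff-scale 0# p n) (zeroˡ _)

  scale-1 : ∀ p → scale 1# p ≋ p
  scale-1 p = coefficientwise λ n → trans (coeff-scale 1# p n) (*-identityˡ _)

  scale-distribʳ : ∀ a b p → scale (a + b) p ≋ scale a p +ᴾ scale b p
  scale-distribʳ a b []      = ≋-refl
  scale-distribʳ a b (d ∷ p) = ∷-cong (distribʳ d a b) (scale-distribʳ a b p)

  scale-distribˡ : ∀ a p q → scale a (p +ᴾ q) ≋ scale a p +ᴾ scale a q
  scale-distribˡ a []      q       = ≋-refl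
  scale-distribˡ a (b ∷ p) []      = ≋-refl
  scale-distribˡ a (b ∷ p) (d ∷ q) = ∷-cong (distribˡ a b d) (scale-distribˡ a p q)

  scale-assoc : ∀ a b p → scale (a * b) p ≋ scale a (scale b p)
  scale-assoc a b []      = ≋-refl
  scale-assoc a b (d ∷ p) = ∷-cong (*-assoc a b d) (scale-assoc a b p)

  scale-shift : ∀ a p → scale a (shift p) ≋ shift (scale a p)
  scale-shift a p = ∷-cong (zeroʳ a) ≋-refl

  shift-+ : ∀ p q → shift (p +ᴾ q) ≋ shift p +ᴾ shift q
  shift-+ p q = ∷-cong (sym (+-identityˡ 0#)) ≋-refl

  *ᴾ-congˡ : ∀ p {q q′} → q ≋ q′ → p *ᴾ q ≋ p *ᴾ q′
  *ᴾ-congˡ []      q≋q′ = ≋-refl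
  *ᴾ-congˡ (a ∷ p) q≋q′ = +ᴾ-cong (scale-cong refl q≋q′) (shift-cong (*ᴾ-congˡ p q≋q′))

  *ᴾ-zeroʳ : ∀ p → p *ᴾ [] ≋ []
  *ᴾ-zeroʳ []      = ≋-refl
  *ᴾ-zeroʳ (a ∷ p) = ≋-trans (shift-cong (*ᴾ-zeroʳ p)) shift-[]

  -- Mirrors the defining recursion in the right factor; with `*ᴾ-zeroʳ` it yields commutativity by
  -- induction.
  *ᴾ-∷ : ∀ p b q → p *ᴾ (b ∷ q) ≋ scale b p +ᴾ shift (p *ᴾ q)
  *ᴾ-∷ []      b q = ≋-sym shift-[]
  *ᴾ-∷ (a ∷ p) b q = ∷-cong (+-cong (*-comm a b) refl) (begin
    scale a q +ᴾ p *ᴾ (b ∷ q)                    ≈⟨ +ᴾ-congˡ (scale a q) (*ᴾ-∷ p b q) ⟩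
    scale a q +ᴾ (scale b p +ᴾ shift (p *ᴾ q))   ≈⟨ +ᴾ-assoc (scale a q) _ _ ⟨
    (scale a q +ᴾ scale b p) +ᴾ shift (p *ᴾ q)   ≈⟨ +ᴾ-cong (+ᴾ-comm (scale a q) _) ≋-refl ⟩
    (scale b p +ᴾ scale a q) +ᴾ shift (p *ᴾ q)   ≈⟨ +ᴾ-assoc (scale b p) _ _ ⟩
    scale b p +ᴾ (scale a q +ᴾ shift (p *ᴾ q))   ∎)

  *ᴾ-comm : ∀ p q → p *ᴾ q ≋ q *ᴾ p
  *ᴾ-comm []      q = ≋-sym (*ᴾ-zeroʳ q)
  *ᴾ-comm (a ∷ p) q = ≋-trans (+ᴾ-congˡ (scale a q) (shift-cong (*ᴾ-comm p q))) (≋-sym (*ᴾ-∷ q a p))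

  -- `*ᴾ-congˡ` varies the factor on which `_*ᴾ_` does not recurse; commutativity moves the other
  -- factor into that place.
  *ᴾ-cong : ∀ {p p′ q q′} → p ≋ p′ → q ≋ q′ → p *ᴾ q ≋ p′ *ᴾ q′
  *ᴾ-cong {p} {p′} {q} {q′} p≋p′ q≋q′ = begin
    p *ᴾ q   ≈⟨ *ᴾ-congˡ p q≋q′ ⟩
    p *ᴾ q′  ≈⟨ *ᴾ-comm p q′ ⟩
    q′ *ᴾ p  ≈⟨ *ᴾ-congˡ q′ p≋p′ ⟩
    q′ *ᴾ p′ ≈⟨ *ᴾ-comm q′ p′ ⟩
    p′ *ᴾ q′ ∎

  *ᴾ-identityˡ : ∀ p → constant 1# *ᴾ p ≋ p
  *ᴾ-identityˡ p = ≋-trans (+ᴾ-cong (scale-1 p) shift-[]) (+ᴾ-identityʳ p)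

  *ᴾ-distribˡ : ∀ p q r → p *ᴾ (q +ᴾ r) ≋ p *ᴾ q +ᴾ p *ᴾ r
  *ᴾ-distribˡ []      q r = ≋-refl
  *ᴾ-distribˡ (a ∷ p) q r = begin
    scale a (q +ᴾ r) +ᴾ shift (p *ᴾ (q +ᴾ r))
      ≈⟨ +ᴾ-cong (scale-distribˡ a q r) (≋-trans (shift-cong (*ᴾ-distribˡ p q r)) (shift-+ (p *ᴾ q) (p *ᴾ r))) ⟩
    (scale a q +ᴾ scale a r) +ᴾ (shift (p *ᴾ q) +ᴾ shift (p *ᴾ r))
      ≈⟨ +ᴾ-interchange (scale a q) (scale a r) _ _ ⟩
    (a ∷ p) *ᴾ q +ᴾ (a ∷ p) *ᴾ r ∎

  *ᴾ-distribʳ : ∀ r p q → (p +ᴾ q) *ᴾ r ≋ p *ᴾ r +ᴾ q *ᴾ r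
  *ᴾ-distribʳ r p q = begin
    (p +ᴾ q) *ᴾ r    ≈⟨ *ᴾ-comm (p +ᴾ q) r ⟩
    r *ᴾ (p +ᴾ q)    ≈⟨ *ᴾ-distribˡ r p q ⟩
    r *ᴾ p +ᴾ r *ᴾ q ≈⟨ +ᴾ-cong (*ᴾ-comm r p) (*ᴾ-comm r q) ⟩
    p *ᴾ r +ᴾ q *ᴾ r ∎

  scale-*ᴾ : ∀ a p q → scale a p *ᴾ q ≋ scale a (p *ᴾ q)
  scale-*ᴾ a []      q = ≋-refl
  scale-*ᴾ a (b ∷ p) q = begin
    scale (a * b) q +ᴾ shift (scale a p *ᴾ q)
      ≈⟨ +ᴾ-cong (scale-assoc a b q) (shift-cong (scale-*ᴾ a p q)) ⟩
    scale a (scale b q) +ᴾ shift (scale a (p *ᴾ q))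
      ≈⟨ +ᴾ-congˡ (scale a (scale b q)) (scale-shift a (p *ᴾ q)) ⟨
    scale a (scale b q) +ᴾ scale a (shift (p *ᴾ q))
      ≈⟨ scale-distribˡ a (scale b q) _ ⟨
    scale a ((b ∷ p) *ᴾ q) ∎

  shift-*ᴾ : ∀ p q → shift p *ᴾ q ≋ shift (p *ᴾ q)
  shift-*ᴾ p q = +ᴾ-cong (scale-0 q) ≋-refl

  *ᴾ-assoc : ∀ p q r → (p *ᴾ q) *ᴾ r ≋ p *ᴾ (q *ᴾ r)
  *ᴾ-assoc []      q r = ≋-refl
  *ᴾ-assoc (a ∷ p) q r = begin
    (scale a q +ᴾ shift (p *ᴾ q)) *ᴾ r       ≈⟨ *ᴾ-distribʳ r (scale a q) _ ⟩
    scale a q *ᴾ r +ᴾ shift (p *ᴾ q) *ᴾ r    ≈⟨ +ᴾ-cong (scale-*ᴾ a q r) (shift-*ᴾ (p *ᴾ q) r) ⟩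
    scale a (q *ᴾ r) +ᴾ shift ((p *ᴾ q) *ᴾ r) ≈⟨ +ᴾ-congˡ (scale a (q *ᴾ r)) (shift-cong (*ᴾ-assoc p q r)) ⟩
    (a ∷ p) *ᴾ (q *ᴾ r)                      ∎

  -- Equality is `_≈ᴾ_` itself rather than its wrapper, and the operations are those of
  -- `Univariate`, so results over this ring speak directly about the polynomials of the theorem.
  -- Iterating the construction gives two variables.
  commutativeRing : CommutativeRing c ℓ
  commutativeRing = record
    { Carrier = Poly
    ; _≈_     = _≈ᴾ_
    ; _+_     = _+ᴾ_
    ; _*_     = _*ᴾ_
    ; -_      = map -_
    ; 0#      = []
    ; 1#      = constant 1#
    ; isCommutativeRing = record
      { isRing = record
        { +-isAbelianGroup = record
          { isGroup = record
            { isMonoid = record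
              { isSemigroup = record
                { isMagma = record
                  { isEquivalence = record
                    { refl  = λ _ → refl
                    ; sym   = λ p≈q n → sym (p≈q n)
                    ; trans = λ p≈q q≈r n → trans (p≈q n) (q≈r n)
                    }
                  ; ∙-cong = λ {p p′ q q′} p≈p′ q≈q′ →
                    at (+ᴾ-cong {p} {p′} {q} {q′} (coefficientwise p≈p′) (coefficientwise q≈q′))
                  }
                ; assoc = λ p q r → at (+ᴾ-assoc p q r)
                }
              ; identity = (λ _ _ → refl) , λ p → at (+ᴾ-identityʳ p)
              }
            ; inverse = (λ p → at (+ᴾ-inverseˡ p))
                      , λ p → at (≋-trans (+ᴾ-comm p (map -_ p)) (+ᴾ-inverseˡ p))
            ; ⁻¹-cong = λ {p q} p≈q → at (neg-cong {p} {q} (coefficientwise p≈q))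
            }
          ; comm = λ p q → at (+ᴾ-comm p q)
          }
        ; *-cong     = λ {p p′ q q′} p≈p′ q≈q′ →
            at (*ᴾ-cong {p} {p′} {q} {q′} (coefficientwise p≈p′) (coefficientwise q≈q′))
        ; *-assoc    = λ p q r → at (*ᴾ-assoc p q r)
        ; *-identity = (λ p → at (*ᴾ-identityˡ p))
                     , λ p → at (≋-trans (*ᴾ-comm p (constant 1#)) (*ᴾ-identityˡ p))
        ; distrib    = (λ p q r → at (*ᴾ-distribˡ p q r)) , λ r p q → at (*ᴾ-distribʳ r p q)
        }
      ; *-comm = λ p q → at (*ᴾ-comm p q)
      }
    }

-- Binomial sums without their last two terms, in a commutative ring.

[1+n]Cn≡1+n : ∀ n → suc n C n ≡ suc n
[1+n]Cn≡1+n n = begin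
  suc n C n           ≡⟨ nCk≡nC[n∸k] (ℕ.n≤1+n n) ⟩
  suc n C (suc n ∸ n) ≡⟨ ≡.cong (suc n C_) (ℕ.m+n∸n≡m 1 n) ⟩
  suc n C 1           ≡⟨ nC1≡n (suc n) ⟩
  suc n               ∎
  where open ≡.≡-Reasoning

module TruncatedBinomial {c ℓ} (R : CommutativeRing c ℓ) where

  open CommutativeRing R
  open import Algebra.Properties.Semiring.Sum semiring
  open import Algebra.Properties.Semiring.Mult semiring
  open import Algebra.Properties.CommutativeSemiring.Exp commutativeSemiring
  open import Algebra.Properties.CommutativeSemiring.Binomial commutativeSemiring
    using () renaming (theorem to binomial-theorem)
  open import Algebra.Properties.Ring ring using (-‿distribˡ-*; -‿distribʳ-*; -‿involutive; ⁻¹-anti-homo‿-)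
  open import Algebra.Solver.Ring.NaturalCoefficients.Default commutativeSemiring
    using (solve; _:=_; _:+_; _:*_; con)
  open import Relation.Binary.Reasoning.Setoid setoid

  -- `sum` unfolds at its first term, whereas the omitted terms stand at the end.
  sum-last : ∀ n (f : ℕ → Carrier) →
             sum {suc n} (f ∘ toℕ) ≈ sum {n} (f ∘ toℕ) + f n
  sum-last zero    f = +-comm (f 0) 0#
  sum-last (suc n) f = trans (+-congˡ (sum-last n (f ∘ suc))) (sym (+-assoc _ _ _))

  scaled-binomial : ∀ a b z s n →
    (a * z + b * s) ^ n ≈
    sum {suc n} (λ i → let k = toℕ i in
      b ^ k * a ^ (n ∸ k) * ((n C k) × 1#) * z ^ (n ∸ k) * s ^ k)
  scaled-binomial a b z s n = begin
    -- The binomial theorem gives the exponent `k` to the first summand, which must therefore be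
    -- `b * s`.
    (a * z + b * s) ^ n ≈⟨ ^-congˡ n (+-comm (a * z) (b * s)) ⟩
    (b * s + a * z) ^ n ≈⟨ binomial-theorem n (b * s) (a * z) ⟩
    _                   ≈⟨ sum-cong-≋ {suc n} (λ i → term (toℕ i)) ⟩
    _                   ∎
    where
    term : ∀ k → (n C k) × ((b * s) ^ k * (a * z) ^ (n ∸ k)) ≈
                 b ^ k * a ^ (n ∸ k) * ((n C k) × 1#) * z ^ (n ∸ k) * s ^ k
    term k = begin
      (n C k) × ((b * s) ^ k * (a * z) ^ (n ∸ k))
        ≈⟨ ×-congʳ (n C k) (*-cong (^-distrib-* b s k) (^-distrib-* a z (n ∸ k))) ⟩
      (n C k) × ((b ^ k * s ^ k) * (a ^ (n ∸ k) * z ^ (n ∸ k)))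
        -- The inserted `1#` turns the multiple by `n C k` into a ring factor `(n C k) × 1#`, an
        -- atom for the solver.
        ≈⟨ ×-congʳ (n C k) (*-identityˡ _) ⟨
      (n C k) × (1# * ((b ^ k * s ^ k) * (a ^ (n ∸ k) * z ^ (n ∸ k))))
        ≈⟨ ×-assoc-* (n C k) 1# _ ⟨
      (n C k) × 1# * ((b ^ k * s ^ k) * (a ^ (n ∸ k) * z ^ (n ∸ k)))
        ≈⟨ solve 5 (λ N B S A Z → N :* ((B :* S) :* (A :* Z)) := B :* A :* N :* Z :* S)
             refl ((n C k) × 1#) (b ^ k) (s ^ k) (a ^ (n ∸ k)) (z ^ (n ∸ k)) ⟩
      b ^ k * a ^ (n ∸ k) * ((n C k) × 1#) * z ^ (n ∸ k) * s ^ k ∎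

  -- The first identity takes `e = -1/2`, `a = 1`, `b = -1/2`; the second takes `e = 1/2`, `a = 2`,
  -- `b = -1`.
  binomialSummand : (e a b u v : Carrier) → ℕ → ℕ → Carrier
  binomialSummand e a b u v n k =
    e * b ^ k * a ^ (n ∸ k) * ((n C k) × 1#) * (u ^ (n ∸ k) + v ^ (n ∸ k)) * (u + v) ^ k

  -- Both powers on the right expand with the same `u + v`, so the two expansions merge term by
  -- term.
  sum-binomialSummand : ∀ e a b u v n →
    sum {suc n} (λ i → binomialSummand e a b u v n (toℕ i)) ≈
    e * ((a * u + b * (u + v)) ^ n + (a * v + b * (u + v)) ^ n)
  sum-binomialSummand e a b u v n = sym (begin
    e * ((a * u + b * s) ^ n + (a * v + b * s) ^ n)
      ≈⟨ *-congˡ (+-cong (scaled-binomial a b u s n) (scaled-binomial a b v s n)) ⟩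
    e * (sum {suc n} (term u ∘ toℕ) + sum {suc n} (term v ∘ toℕ))
      ≈⟨ *-congˡ (∑-distrib-+ {suc n} (term u ∘ toℕ) (term v ∘ toℕ)) ⟨
    e * sum {suc n} (λ i → term u (toℕ i) + term v (toℕ i))
      ≈⟨ *-distribˡ-sum {suc n} e (λ i → term u (toℕ i) + term v (toℕ i)) ⟩
    sum {suc n} (λ i → e * (term u (toℕ i) + term v (toℕ i)))
      ≈⟨ sum-cong-≋ {suc n} (λ i → collect (toℕ i)) ⟩
    _ ∎)
    where
    s = u + v
    term : Carrier → ℕ → Carrier
    term z k = b ^ k * a ^ (n ∸ k) * ((n C k) × 1#) * z ^ (n ∸ k) * s ^ k
    collect : ∀ k → e * (term u k + term v k) ≈ binomialSummand e a b u v n k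
    collect k = solve 7 (λ E B A N U V S →
        E :* (B :* A :* N :* U :* S :+ B :* A :* N :* V :* S) :=
        E :* B :* A :* N :* (U :+ V) :* S) refl
      e (b ^ k) (a ^ (n ∸ k)) ((n C k) × 1#) (u ^ (n ∸ k)) (v ^ (n ∸ k)) (s ^ k)

  -- When a = -2b, both linear forms collapse to multiples of u - v:
  -- a u + b (u + v) = b (v - u).
  linear-form : ∀ {a b} u v → a + (b + b) ≈ 0# → a * u + b * (u + v) ≈ b * (v - u)
  linear-form {a} {b} u v a+2b≈0 = begin
    a * u + b * (u + v)                       ≈⟨ +-identityʳ _ ⟨
    -- The solver knows semirings only and sees `- u` as an atom `W`. Adding `b * (u - u)` supplies
    -- the terms that make the next equation hold for every `W`.
    a * u + b * (u + v) + 0#                  ≈⟨ +-congˡ (trans (sym (zeroʳ b)) (*-congˡ (sym (-‿inverseʳ u)))) ⟩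
    a * u + b * (u + v) + b * (u - u)         ≈⟨ solve 5 (λ A B U V W →
                                                   A :* U :+ B :* (U :+ V) :+ B :* (U :+ W) :=
                                                   (A :+ (B :+ B)) :* U :+ B :* (V :+ W)) refl a b u v (- u) ⟩
    (a + (b + b)) * u + b * (v - u)           ≈⟨ +-congʳ (trans (*-congʳ a+2b≈0) (zeroˡ u)) ⟩
    0# + b * (v - u)                          ≈⟨ +-identityˡ _ ⟩
    b * (v - u)                               ∎

  -- Here `n ∸ k` is 1, so the sum of powers is `u + v` and raises the power of `u + v` to `n`.
  penultimate-summand : ∀ e a b u v j → let n = suc (suc j) in
    binomialSummand e a b u v n (suc j) ≈ e * b ^ suc j * a * (n × 1#) * (u + v) ^ n
  penultimate-summand e a b u v j = begin
    binomialSummand e a b u v n (suc j)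
      ≡⟨ ≡.cong₂ (λ r N → e * b ^ suc j * a ^ r * (N × 1#) * (u ^ r + v ^ r) * (u + v) ^ suc j)
           (ℕ.m+n∸n≡m 1 (suc j)) ([1+n]Cn≡1+n (suc j)) ⟩
    e * b ^ suc j * a ^ 1 * (n × 1#) * (u ^ 1 + v ^ 1) * (u + v) ^ suc j
      ≈⟨ solve 6 (λ E A N U V S →
           E :* (A :* con 1) :* N :* (U :* con 1 :+ V :* con 1) :* S :=
           E :* A :* N :* ((U :+ V) :* S)) refl
           (e * b ^ suc j) a (n × 1#) u v ((u + v) ^ suc j) ⟩
    e * b ^ suc j * a * (n × 1#) * (u + v) ^ n ∎
    where n = suc (suc j)

  -- Here `n ∸ k` is 0, so `a` drops out and the two powers add up to 2.
  last-summand : ∀ e a b u v n →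
    binomialSummand e a b u v n n ≈ e * b ^ n * (1# + 1#) * (u + v) ^ n
  last-summand e a b u v n = begin
    binomialSummand e a b u v n n
      ≡⟨ ≡.cong₂ (λ r N → e * b ^ n * a ^ r * (N × 1#) * (u ^ r + v ^ r) * (u + v) ^ n)
           (ℕ.n∸n≡0 n) (nCn≡1 n) ⟩
    e * b ^ n * 1# * (1 × 1#) * (1# + 1#) * (u + v) ^ n
      ≈⟨ *-congʳ (*-congʳ (trans (*-cong (*-identityʳ _) (+-identityʳ 1#)) (*-identityʳ _))) ⟩
    e * b ^ n * (1# + 1#) * (u + v) ^ n ∎

  -- The two missing terms and `X` add up to zero. Adding all three completes the range to `k ≤ n`,
  -- where the binomial theorem applies, and leaves `X` as the correction.
  truncated-binomial-sum : ∀ e a b u v j → a + (b + b) ≈ 0# → let n = suc (suc j) in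
    sum {suc j} (λ i → binomialSummand e a b u v n (toℕ i)) ≈
    e * b ^ n * ((2 ℕ.* suc j) × 1#) * (u + v) ^ n + e * b ^ n * ((u - v) ^ n + (v - u) ^ n)
  truncated-binomial-sum e a b u v j a+2b≈0 = begin
    ∑                                 ≈⟨ +-identityʳ ∑ ⟨
    ∑ + 0#                            ≈⟨ +-congˡ tail-cancels ⟨
    ∑ + (T (suc j) + T n + X)         ≈⟨ solve 4 (λ S P Q X → S :+ (P :+ Q :+ X) := X :+ (S :+ P :+ Q))
                                           refl ∑ (T (suc j)) (T n) X ⟩
    X + (∑ + T (suc j) + T n)         ≈⟨ +-congˡ (+-congʳ (sum-last (suc j) T)) ⟨
    X + (sum {n} (T ∘ toℕ) + T n)     ≈⟨ +-congˡ (sum-last n T) ⟨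
    X + sum {suc n} (T ∘ toℕ)         ≈⟨ +-congˡ (sum-binomialSummand e a b u v n) ⟩
    X + e * ((a * u + b * (u + v)) ^ n + (a * v + b * (u + v)) ^ n)
      -- For the second form the roles of `u` and `v` are exchanged, hence `u + v` must first become
      -- `v + u`.
      ≈⟨ +-congˡ (*-congˡ (+-cong (power u v (linear-form u v a+2b≈0))
                                  (power v u (trans (+-congˡ (*-congˡ (+-comm u v))) (linear-form v u a+2b≈0))))) ⟩
    X + e * (b ^ n * (v - u) ^ n + b ^ n * (u - v) ^ n)
      ≈⟨ +-congˡ (solve 4 (λ E B P Q → E :* (B :* P :+ B :* Q) := E :* B :* (Q :+ P))
           refl e (b ^ n) ((v - u) ^ n) ((u - v) ^ n)) ⟩
    X + e * b ^ n * ((u - v) ^ n + (v - u) ^ n) ∎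
    where
    n = suc (suc j)
    T = binomialSummand e a b u v n
    ∑ = sum {suc j} (T ∘ toℕ)
    X = e * b ^ n * ((2 ℕ.* suc j) × 1#) * (u + v) ^ n

    power : ∀ {w} z z′ → w ≈ b * (z′ - z) → w ^ n ≈ b ^ n * (z′ - z) ^ n
    power z z′ w≈ = trans (^-congˡ n w≈) (^-distrib-* b (z′ - z) n)

    -- Up to the common factor `e * b ^ (n-1) * S`, the three terms are `a n`, `2 b` and
    -- `2 b (n-1)`, with sum `(a + 2 b) n`.
    tail-cancels : T (suc j) + T n + X ≈ 0#
    tail-cancels = begin
      T (suc j) + T n + X
        ≈⟨ +-cong (+-cong (penultimate-summand e a b u v j) (last-summand e a b u v n))
                  (*-congʳ (*-congˡ (trans (×1-homo-* 2 (suc j)) (*-congʳ (+-congˡ (+-identityʳ 1#)))))) ⟩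
      e * b ^ suc j * a * (1# + suc j × 1#) * S
        + e * (b * b ^ suc j) * (1# + 1#) * S
        + e * (b * b ^ suc j) * ((1# + 1#) * (suc j × 1#)) * S
        ≈⟨ solve 6 (λ E P A B N S →
             E :* P :* A :* (con 1 :+ N) :* S
             :+ E :* (B :* P) :* (con 1 :+ con 1) :* S
             :+ E :* (B :* P) :* ((con 1 :+ con 1) :* N) :* S
             := (A :+ (B :+ B)) :* (E :* P :* (con 1 :+ N) :* S))
           refl e (b ^ suc j) a b (suc j × 1#) S ⟩
      (a + (b + b)) * (e * b ^ suc j * (1# + suc j × 1#) * S)
        ≈⟨ trans (*-congʳ a+2b≈0) (zeroˡ _) ⟩
      0# ∎
      where S = (u + v) ^ n

  neg-square : ∀ z → (- z) ^ 2 ≈ z ^ 2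
  neg-square z = begin
    - z * (- z * 1#)  ≈⟨ *-congˡ (*-identityʳ (- z)) ⟩
    - z * - z         ≈⟨ -‿distribˡ-* z (- z) ⟨
    - (z * - z)       ≈⟨ -‿cong (-‿distribʳ-* z z) ⟨
    - - (z * z)       ≈⟨ -‿involutive (z * z) ⟩
    z * z             ≈⟨ *-congˡ (*-identityʳ z) ⟨
    z * (z * 1#)      ∎

  neg-even-power : ∀ z m → (- z) ^ (2 ℕ.* m) ≈ z ^ (2 ℕ.* m)
  neg-even-power z m = begin
    (- z) ^ (2 ℕ.* m) ≈⟨ ^-assocʳ (- z) 2 m ⟨
    ((- z) ^ 2) ^ m   ≈⟨ ^-congˡ m (neg-square z) ⟩
    (z ^ 2) ^ m       ≈⟨ ^-assocʳ z 2 m ⟩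
    z ^ (2 ℕ.* m)     ∎

  swap-even-power : ∀ u v m → (v - u) ^ (2 ℕ.* m) ≈ (u - v) ^ (2 ℕ.* m)
  swap-even-power u v m =
    trans (^-congˡ (2 ℕ.* m) (sym (⁻¹-anti-homo‿- u v))) (neg-even-power (u - v) m)

  -- One factor splits off and changes sign under the swap; the remaining even power is symmetric.
  swap-odd-power-cancels : ∀ u v m → (u - v) ^ suc (2 ℕ.* m) + (v - u) ^ suc (2 ℕ.* m) ≈ 0#
  swap-odd-power-cancels u v m = begin
    (u - v) * P + (v - u) * (v - u) ^ (2 ℕ.* m) ≈⟨ +-congˡ (*-cong (sym (⁻¹-anti-homo‿- u v)) (swap-even-power u v m)) ⟩
    (u - v) * P + - (u - v) * P                 ≈⟨ distribʳ P (u - v) (- (u - v)) ⟨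
    ((u - v) - (u - v)) * P                     ≈⟨ trans (*-congʳ (-‿inverseʳ (u - v))) (zeroˡ P) ⟩
    0#                                          ∎
    where P = (u - v) ^ (2 ℕ.* m)

-- Arithmetic of the rational coefficients.

module Rationals where

  open CommutativeRing ℚ.+-*-commutativeRing using (semiring; commutativeSemiring)
  open import Algebra.Properties.Semiring.Mult semiring using (_×_; ×1-homo-*)
  open import Algebra.Properties.CommutativeSemiring.Exp commutativeSemiring
    using (^-assocʳ; ^-distrib-*)
  -- Passing to unnormalised fractions avoids the gcd in `ℚ._/_`; equations then become
  -- cross-multiplications of integers.
  toℚᵘ-/ : ∀ m n → toℚᵘ (+ m ℚ./ suc n) ℚᵘ.≃ ℚᵘ.mkℚᵘ (+ m) n
  toℚᵘ-/ m n = ℚ.toℚᵘ-fromℚᵘ (ℚᵘ.mkℚᵘ (+ m) n)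

  fromℕ-suc : ∀ n → fromℕ (suc n) ≡ 1ℚ ℚ.+ fromℕ n
  fromℕ-suc n = ℚ.toℚᵘ-injective (begin
    toℚᵘ (fromℕ (suc n))            ≈⟨ toℚᵘ-/ (suc n) 0 ⟩
    ℚᵘ.mkℚᵘ (+ suc n) 0             ≈⟨ ℚᵘ.*≡* (≡.cong (λ i → (+ 1 ℤ.+ i) ℤ.* + 1) (≡.sym (ℤ.*-identityʳ (+ n)))) ⟩
    ℚᵘ.1ℚᵘ ℚᵘ.+ ℚᵘ.mkℚᵘ (+ n) 0     ≈⟨ ℚᵘ.+-congʳ ℚᵘ.1ℚᵘ (toℚᵘ-/ n 0) ⟨
    toℚᵘ 1ℚ ℚᵘ.+ toℚᵘ (fromℕ n)     ≈⟨ ℚ.toℚᵘ-homo-+ 1ℚ (fromℕ n) ⟨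
    toℚᵘ (1ℚ ℚ.+ fromℕ n)           ∎)
    where open import Relation.Binary.Reasoning.Setoid ℚᵘ.≃-setoid

  /-*-cancel : ∀ m n .{{_ : NonZero n}} → (+ m ℚ./ n) ℚ.* fromℕ n ≡ fromℕ m
  /-*-cancel m (suc n) = ℚ.toℚᵘ-injective (begin
    toℚᵘ ((+ m ℚ./ suc n) ℚ.* fromℕ (suc n))        ≈⟨ ℚ.toℚᵘ-homo-* (+ m ℚ./ suc n) (fromℕ (suc n)) ⟩
    toℚᵘ (+ m ℚ./ suc n) ℚᵘ.* toℚᵘ (fromℕ (suc n))  ≈⟨ ℚᵘ.*-cong (toℚᵘ-/ m n) (toℚᵘ-/ (suc n) 0) ⟩
    ℚᵘ.mkℚᵘ (+ m) n ℚᵘ.* ℚᵘ.mkℚᵘ (+ suc n) 0        ≈⟨ ℚᵘ.*≡* (ℤ.*-assoc (+ m) (+ suc n) (+ 1)) ⟩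
    ℚᵘ.mkℚᵘ (+ m) 0                                 ≈⟨ toℚᵘ-/ m 0 ⟨
    toℚᵘ (fromℕ m)                                  ∎)
    where open import Relation.Binary.Reasoning.Setoid ℚᵘ.≃-setoid

  open ≡.≡-Reasoning

  -- Lets `fromℕ` inherit multiplicativity from multiples of one.
  fromℕ≡×1 : ∀ n → fromℕ n ≡ n × 1ℚ
  fromℕ≡×1 zero    = ≡.refl
  fromℕ≡×1 (suc n) = ≡.trans (fromℕ-suc n) (≡.cong (1ℚ ℚ.+_) (fromℕ≡×1 n))

  fromℕ-* : ∀ m n → fromℕ (m ℕ.* n) ≡ fromℕ m ℚ.* fromℕ n
  fromℕ-* m n = begin
    fromℕ (m ℕ.* n)         ≡⟨ fromℕ≡×1 (m ℕ.* n) ⟩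
    (m ℕ.* n) × 1ℚ          ≡⟨ ×1-homo-* m n ⟩
    (m × 1ℚ) ℚ.* (n × 1ℚ)   ≡⟨ ≡.cong₂ ℚ._*_ (fromℕ≡×1 m) (fromℕ≡×1 n) ⟨
    fromℕ m ℚ.* fromℕ n     ∎

  fromℕ-^ : ∀ m n → fromℕ (m ℕ.^ n) ≡ fromℕ m ^ℚ n
  fromℕ-^ m zero    = ≡.refl
  fromℕ-^ m (suc n) = ≡.trans (fromℕ-* m (m ℕ.^ n)) (≡.cong (fromℕ m ℚ.*_) (fromℕ-^ m n))

  1^n≡1 : ∀ n → 1ℚ ^ℚ n ≡ 1ℚ
  1^n≡1 zero    = ≡.refl
  1^n≡1 (suc n) = ≡.trans (ℚ.*-identityˡ _) (1^n≡1 n)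

  /2^-≡-*½^ : ∀ m p → ℚ._/_ (+ m) (2 ℕ.^ p) {{m^n≢0 2 p}} ≡ fromℕ m ℚ.* ½ ^ℚ p
  /2^-≡-*½^ m p = begin
    q                                       ≡⟨ ℚ.*-identityʳ q ⟨
    -- The base 1 is read as `fromℕ 2 ℚ.* ½`, to which it is equal by computation; the power of 2
    -- then cancels the denominator.
    q ℚ.* 1ℚ                                ≡⟨ ≡.cong (q ℚ.*_) (1^n≡1 p) ⟨
    q ℚ.* (fromℕ 2 ℚ.* ½) ^ℚ p              ≡⟨ ≡.cong (q ℚ.*_) (^-distrib-* (fromℕ 2) ½ p) ⟩
    q ℚ.* (fromℕ 2 ^ℚ p ℚ.* ½ ^ℚ p)         ≡⟨ ℚ.*-assoc q _ _ ⟨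
    q ℚ.* fromℕ 2 ^ℚ p ℚ.* ½ ^ℚ p           ≡⟨ ≡.cong (λ r → q ℚ.* r ℚ.* ½ ^ℚ p) (fromℕ-^ 2 p) ⟨
    q ℚ.* fromℕ (2 ℕ.^ p) ℚ.* ½ ^ℚ p        ≡⟨ ≡.cong (ℚ._* ½ ^ℚ p) (/-*-cancel m (2 ℕ.^ p) {{m^n≢0 2 p}}) ⟩
    fromℕ m ℚ.* ½ ^ℚ p                      ∎
    where q = ℚ._/_ (+ m) (2 ℕ.^ p) {{m^n≢0 2 p}}

  -- For concrete numbers that differ in sign, equality of the squares is a computation.
  even-power-cong : ∀ {a b} m → a ^ℚ 2 ≡ b ^ℚ 2 → a ^ℚ (2 ℕ.* m) ≡ b ^ℚ (2 ℕ.* m)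
  even-power-cong {a} {b} m a²≡b² = begin
    a ^ℚ (2 ℕ.* m)  ≡⟨ ^-assocʳ a 2 m ⟨
    (a ^ℚ 2) ^ℚ m   ≡⟨ ≡.cong (_^ℚ m) a²≡b² ⟩
    (b ^ℚ 2) ^ℚ m   ≡⟨ ^-assocʳ b 2 m ⟩
    b ^ℚ (2 ℕ.* m)  ∎

  -- With `e = b`, the factor `e` supplies the extra power of `-½`.
  odd-coefficient : ∀ k r c →
    (-½ ^ℚ (k ℕ.+ 1)) ℚ.* c ≡ -½ ℚ.* -½ ^ℚ k ℚ.* 1ℚ ^ℚ r ℚ.* c
  odd-coefficient k r c rewrite ℕ.+-comm k 1 | 1^n≡1 r =
    ≡.cong (ℚ._* c) (≡.sym (ℚ.*-identityʳ (-½ ℚ.* -½ ^ℚ k)))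

  -- The factor ½ lowers the exponent of 2 by one; `r ≥ 1` makes `r ∸ 1` the true difference. `s`
  -- stands for the sign.
  even-coefficient : ∀ s r c → r ≥ 1 →
    s ℚ.* fromℕ (2 ℕ.^ (r ∸ 1)) ℚ.* c ≡ ½ ℚ.* s ℚ.* fromℕ 2 ^ℚ r ℚ.* c
  even-coefficient s (suc r) c _ rewrite fromℕ-^ 2 r =
    solve 3 (λ s t c → s :* t :* c := con ½ :* s :* (con (fromℕ 2) :* t) :* c) ≡.refl
      s (fromℕ 2 ^ℚ r) c
    where open +-*-Solver

  -- This is `2 (n-1) e b^n` for `n = 2m + 1`: the two extra factors `-½` cancel the 4 in `4m`.
  odd-constant : ∀ m →
    -½ ℚ.* -½ ^ℚ suc (2 ℕ.* m) ℚ.* fromℕ (2 ℕ.* (2 ℕ.* m)) ≡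
    ℚ._/_ (+ m) (2 ℕ.^ (2 ℕ.* m)) {{m^n≢0 2 (2 ℕ.* m)}}
  odd-constant m = begin
    -½ ℚ.* (-½ ℚ.* -½ ^ℚ p) ℚ.* fromℕ (2 ℕ.* p)
      ≡⟨ ≡.cong₂ (λ r s → -½ ℚ.* (-½ ℚ.* r) ℚ.* s) (even-power-cong m ≡.refl)
           (≡.trans (fromℕ-* 2 p) (≡.cong (fromℕ 2 ℚ.*_) (fromℕ-* 2 m))) ⟩
    -½ ℚ.* (-½ ℚ.* ½ ^ℚ p) ℚ.* (fromℕ 2 ℚ.* (fromℕ 2 ℚ.* fromℕ m))
      ≡⟨ solve 2 (λ r s → con -½ :* (con -½ :* r) :* (con (fromℕ 2) :* (con (fromℕ 2) :* s))
                          := s :* r) ≡.refl (½ ^ℚ p) (fromℕ m) ⟩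
    fromℕ m ℚ.* ½ ^ℚ p
      ≡⟨ /2^-≡-*½^ m p ⟨
    ℚ._/_ (+ m) (2 ℕ.^ p) {{m^n≢0 2 p}} ∎
    where
    p = 2 ℕ.* m
    open +-*-Solver

  [-1]^2m≡1 : ∀ m → (ℚ.- 1ℚ) ^ℚ (2 ℕ.* m) ≡ 1ℚ
  [-1]^2m≡1 m = ≡.trans (even-power-cong m ≡.refl) (1^n≡1 (2 ℕ.* m))

  even-constant : ∀ m j →
    ½ ℚ.* (ℚ.- 1ℚ) ^ℚ (2 ℕ.* m) ℚ.* fromℕ (2 ℕ.* j) ≡ fromℕ j
  even-constant m j rewrite [-1]^2m≡1 m | fromℕ-* 2 j =
    solve 1 (λ r → con ½ :* con 1ℚ :* (con (fromℕ 2) :* r) := r) ≡.refl (fromℕ j)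
    where open +-*-Solver

-- Both identities in a commutative ring with a homomorphism from the rationals.

module RationalAlgebra {c ℓ} (R : CommutativeRing c ℓ)
  (ι : ℚ → CommutativeRing.Carrier R)
  (ι-homo : SemiringMorphisms.IsSemiringHomomorphism
              ℚ.+-*-rawSemiring (Semiring.rawSemiring (CommutativeRing.semiring R)) ι)
  where

  open CommutativeRing R
  open SemiringMorphisms.IsSemiringHomomorphism ι-homo using (+-homo; *-homo; 0#-homo; 1#-homo)
  open import Algebra.Properties.Semiring.Sum semiring using (sum; sum-cong-≋)
  open import Algebra.Properties.Semiring.Mult semiring using (_×_)
  open import Algebra.Properties.CommutativeSemiring.Exp commutativeSemiring using (_^_)
  open import Relation.Binary.Reasoning.Setoid setoid
  open Rationals
  open TruncatedBinomial R

  ι-fromℕ : ∀ n → ι (fromℕ n) ≈ n × 1#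
  ι-fromℕ zero    = 0#-homo
  ι-fromℕ (suc n) = begin
    ι (fromℕ (suc n))       ≡⟨ ≡.cong ι (fromℕ-suc n) ⟩
    ι (1ℚ ℚ.+ fromℕ n)      ≈⟨ +-homo 1ℚ (fromℕ n) ⟩
    ι 1ℚ + ι (fromℕ n)      ≈⟨ +-cong 1#-homo (ι-fromℕ n) ⟩
    1# + n × 1#             ∎

  ι-^ : ∀ q n → ι (q ^ℚ n) ≈ ι q ^ n
  ι-^ q zero    = 1#-homo
  ι-^ q (suc n) = trans (*-homo q (q ^ℚ n)) (*-congˡ (ι-^ q n))

  ι-constant : ∀ e b n N →
    ι (e ℚ.* b ^ℚ n ℚ.* fromℕ N) ≈ ι e * ι b ^ n * (N × 1#)
  ι-constant e b n N =
    trans (*-homo _ _) (*-cong (trans (*-homo _ _) (*-congˡ (ι-^ b n))) (ι-fromℕ N))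

  ι-coefficient : ∀ e a b k r N →
    ι (e ℚ.* b ^ℚ k ℚ.* a ^ℚ r ℚ.* fromℕ N) ≈ ι e * ι b ^ k * ι a ^ r * (N × 1#)
  ι-coefficient e a b k r N = trans (*-homo _ _) (*-cong
    (trans (*-homo _ _) (*-cong (trans (*-homo _ _) (*-congˡ (ι-^ b k))) (ι-^ a r)))
    (ι-fromℕ N))

  -- Keeps each weight as one rational under `ι`, as in the theorem. The condition on `w` is
  -- confined to `k ≤ j`, where `n ∸ k` is positive, as `even-coefficient` demands.
  truncated-sum : ∀ (w : ℕ → ℚ) e a b u v j → let n = suc (suc j) in
    a ℚ.+ (b ℚ.+ b) ≡ 0ℚ →
    (∀ k → k ≤ j → w k ≡ e ℚ.* b ^ℚ k ℚ.* a ^ℚ (n ∸ k) ℚ.* fromℕ (n C k)) →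
    sum {suc j} (λ i → let k = toℕ i in
      ι (w k) * (u ^ (n ∸ k) + v ^ (n ∸ k)) * (u + v) ^ k) ≈
    ι (e ℚ.* b ^ℚ n ℚ.* fromℕ (2 ℕ.* suc j)) * (u + v) ^ n
      + ι e * ι b ^ n * ((u - v) ^ n + (v - u) ^ n)
  truncated-sum w e a b u v j a+2b≡0 w≡ = begin
    _ ≈⟨ sum-cong-≋ {suc j} (λ i → summand (toℕ i) (Fin.toℕ≤pred[n] i)) ⟩
    sum {suc j} (λ i → binomialSummand (ι e) (ι a) (ι b) u v n (toℕ i))
      ≈⟨ truncated-binomial-sum (ι e) (ι a) (ι b) u v j ιa+2ιb≈0 ⟩
    ι e * ι b ^ n * ((2 ℕ.* suc j) × 1#) * (u + v) ^ n + ι e * ι b ^ n * ((u - v) ^ n + (v - u) ^ n)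
      ≈⟨ +-congʳ (*-congʳ (ι-constant e b n (2 ℕ.* suc j))) ⟨
    _ ∎
    where
    n = suc (suc j)
    summand : ∀ k → k ≤ j →
      ι (w k) * (u ^ (n ∸ k) + v ^ (n ∸ k)) * (u + v) ^ k ≈ binomialSummand (ι e) (ι a) (ι b) u v n k
    summand k k≤j = *-congʳ (*-congʳ (trans (reflexive (≡.cong ι (w≡ k k≤j)))
                                            (ι-coefficient e a b k (n ∸ k) (n C k))))

    ιa+2ιb≈0 : ι a + (ι b + ι b) ≈ 0#
    ιa+2ιb≈0 = begin
      ι a + (ι b + ι b)       ≈⟨ +-congˡ (+-homo b b) ⟨
      ι a + ι (b ℚ.+ b)       ≈⟨ +-homo a (b ℚ.+ b) ⟨
      ι (a ℚ.+ (b ℚ.+ b))     ≡⟨ ≡.cong ι a+2b≡0 ⟩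
      ι 0ℚ                    ≈⟨ 0#-homo ⟩
      0#                      ∎

  -- The separate variable `p` can be matched with `suc j`, which the stuck term `2 ℕ.* m` does not
  -- allow; `n = p + 1` then has the form `suc (suc j)`.
  odd-identity : ∀ u v m p → p ≡ 2 ℕ.* m → p ≥ 1 →
    sum {suc (p ∸ 1)} (λ i → let k = toℕ i in
      ι ((-½ ^ℚ (k ℕ.+ 1)) ℚ.* fromℕ ((p ℕ.+ 1) C k))
        * (u ^ (p ℕ.+ 1 ∸ k) + v ^ (p ℕ.+ 1 ∸ k)) * (u + v) ^ k) ≈
    ι (ℚ._/_ (+ m) (2 ℕ.^ p) {{m^n≢0 2 p}}) * (u + v) ^ (p ℕ.+ 1)
  odd-identity u v m p@(suc j) p≡2m _ rewrite ℕ.+-comm j 1 = begin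
    _ ≈⟨ truncated-sum (λ k → (-½ ^ℚ (k ℕ.+ 1)) ℚ.* fromℕ (suc p C k)) -½ 1ℚ -½ u v j ≡.refl
           (λ k _ → odd-coefficient k (suc p ∸ k) (fromℕ (suc p C k))) ⟩
    ι (-½ ℚ.* -½ ^ℚ suc p ℚ.* fromℕ (2 ℕ.* p)) * (u + v) ^ suc p
      + ι -½ * ι -½ ^ suc p * ((u - v) ^ suc p + (v - u) ^ suc p)
      ≈⟨ +-cong (*-congʳ (reflexive (≡.cong ι (constant p p≡2m))))
                (trans (*-congˡ (cancels p p≡2m)) (zeroʳ _)) ⟩
    ι (ℚ._/_ (+ m) (2 ℕ.^ p) {{m^n≢0 2 p}}) * (u + v) ^ suc p + 0#
      ≈⟨ +-identityʳ _ ⟩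
    _ ∎
    where
    -- Quantifying `p` afresh lets the equation be matched with `≡.refl`, which fails for `suc j`.
    constant : ∀ p → p ≡ 2 ℕ.* m →
      -½ ℚ.* -½ ^ℚ suc p ℚ.* fromℕ (2 ℕ.* p) ≡ ℚ._/_ (+ m) (2 ℕ.^ p) {{m^n≢0 2 p}}
    constant _ ≡.refl = odd-constant m
    cancels : ∀ p → p ≡ 2 ℕ.* m → (u - v) ^ suc p + (v - u) ^ suc p ≈ 0#
    cancels _ ≡.refl = swap-odd-power-cancels u v m

  even-identity : ∀ u v m n → n ≡ 2 ℕ.* m → n ≥ 2 →
    sum {suc (n ∸ 2)} (λ i → let k = toℕ i in
      ι (((ℚ.- 1ℚ) ^ℚ k) ℚ.* fromℕ (2 ℕ.^ (n ∸ k ∸ 1)) ℚ.* fromℕ (n C k))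
        * (u ^ (n ∸ k) + v ^ (n ∸ k)) * (u + v) ^ k) ≈
    ι (fromℕ (n ∸ 1)) * (u + v) ^ n + (u - v) ^ n
  even-identity u v m n@(suc (suc j)) n≡2m (s≤s (s≤s _)) = begin
    _ ≈⟨ truncated-sum
           (λ k → ((ℚ.- 1ℚ) ^ℚ k) ℚ.* fromℕ (2 ℕ.^ (n ∸ k ∸ 1)) ℚ.* fromℕ (n C k))
           ½ (fromℕ 2) (ℚ.- 1ℚ) u v j ≡.refl
           (λ k k≤j → even-coefficient ((ℚ.- 1ℚ) ^ℚ k) (n ∸ k) (fromℕ (n C k))
                      -- `k ≤ j` gives `k < n`, so the exponent `n ∸ k` is at least 1.
                      (ℕ.m<n⇒0<n∸m (s≤s (ℕ.m≤n⇒m≤1+n k≤j)))) ⟩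
    ι (½ ℚ.* (ℚ.- 1ℚ) ^ℚ n ℚ.* fromℕ (2 ℕ.* suc j)) * (u + v) ^ n
      + ι ½ * ι (ℚ.- 1ℚ) ^ n * ((u - v) ^ n + (v - u) ^ n)
      ≈⟨ +-cong (*-congʳ (reflexive (≡.cong ι (constant n n≡2m)))) (average n n≡2m) ⟩
    ι (fromℕ (suc j)) * (u + v) ^ n + (u - v) ^ n ∎
    where
    constant : ∀ n → n ≡ 2 ℕ.* m → ½ ℚ.* (ℚ.- 1ℚ) ^ℚ n ℚ.* fromℕ (2 ℕ.* suc j) ≡ fromℕ (suc j)
    constant _ ≡.refl = even-constant m (suc j)
    -- For even `n` the power of -1 is 1 and both powers of the difference agree, so ½ takes the
    -- mean of two equal terms.
    average : ∀ n → n ≡ 2 ℕ.* m →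
      ι ½ * ι (ℚ.- 1ℚ) ^ n * ((u - v) ^ n + (v - u) ^ n) ≈ (u - v) ^ n
    average n ≡.refl = begin
      ι ½ * ι (ℚ.- 1ℚ) ^ n * (W + (v - u) ^ n)
        ≈⟨ *-cong (*-congˡ (trans (sym (ι-^ (ℚ.- 1ℚ) n)) (trans (reflexive (≡.cong ι ([-1]^2m≡1 m))) 1#-homo)))
                  (+-congˡ (swap-even-power u v m)) ⟩
      ι ½ * 1# * (W + W)      ≈⟨ *-congʳ (*-identityʳ (ι ½)) ⟩
      ι ½ * (W + W)           ≈⟨ distribˡ (ι ½) W W ⟩
      ι ½ * W + ι ½ * W       ≈⟨ distribʳ W (ι ½) (ι ½) ⟨
      (ι ½ + ι ½) * W         ≈⟨ *-congʳ (trans (sym (+-homo ½ ½)) 1#-homo) ⟩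
      1# * W                  ≈⟨ *-identityˡ W ⟩
      W                       ∎
      where W = (u - v) ^ n

-- Specialisation to polynomials in two variables over the rationals.

module ℚ[x]   = PolynomialRing ℚ.+-*-commutativeRing
module ℚ[x,y] = PolynomialRing ℚ[x].commutativeRing

open import Data.Product.Base using (_×_)
open import Defs

const-isSemiringHomomorphism : SemiringMorphisms.IsSemiringHomomorphism ℚ.+-*-rawSemiring
  (Semiring.rawSemiring (CommutativeRing.semiring ℚ[x,y].commutativeRing)) const
const-isSemiringHomomorphism = record
  { isNearSemiringHomomorphism = record
    { +-isMonoidHomomorphism = record
      { isMagmaHomomorphism = record
        { isRelHomomorphism = record { cong = λ { ≡.refl _ _ → ≡.refl } }
        ; homo              = λ _ _ _ _ → ≡.refl
        }
      -- `const 0ℚ` is a nonempty list while zero is `[]`, so coefficients are compared by cases.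
      ; ε-homo = λ { zero zero → ≡.refl ; zero (suc _) → ≡.refl ; (suc _) _ → ≡.refl }
      }
    -- The product of the constants computes to `const (p ℚ.* q ℚ.+ 0ℚ)`; the zero comes from the
    -- shifted part of the recursion.
    ; *-homo = λ p q i j →
        ≡.cong (λ r → ℚ[x]-coeff (ℚ[x,y]-coeff (const r) i) j) (≡.sym (ℚ.+-identityʳ (p ℚ.* q)))
    }
  ; 1#-homo = λ _ _ → ≡.refl
  }
  where
  open Univariate ℚ.+-*-rawRing using () renaming (coeff to ℚ[x]-coeff)
  open Univariate (CommutativeRing.rawRing ℚ[x].commutativeRing) using ()
    renaming (coeff to ℚ[x,y]-coeff)

open RationalAlgebra ℚ[x,y].commutativeRing const const-isSemiringHomomorphism
  using (odd-identity; even-identity)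

mainTheorem8 : (m : ℕ) → m ≥ 1 →
  ( ∑[ k ≤ 2 ℕ.* m ∸ 1 ] (const ((-½ ^ℚ (k ℕ.+ 1)) ℚ.* fromℕ ((2 ℕ.* m ℕ.+ 1) C k)) * (x ^ (2 ℕ.* m ℕ.+ 1 ∸ k) + y ^ (2 ℕ.* m ℕ.+ 1 ∸ k)) * (x + y) ^ k)
    ≈ const (ℚ._/_ (+ m) (2 ℕ.^ (2 ℕ.* m)) {{m^n≢0 2 (2 ℕ.* m)}}) * (x + y) ^ (2 ℕ.* m ℕ.+ 1) )
  ×
  ( ∑[ k ≤ 2 ℕ.* m ∸ 2 ] (const (((ℚ.- 1ℚ) ^ℚ k) ℚ.* fromℕ (2 ℕ.^ (2 ℕ.* m ∸ k ∸ 1)) ℚ.* fromℕ ((2 ℕ.* m) C k)) * (x ^ (2 ℕ.* m ∸ k) + y ^ (2 ℕ.* m ∸ k)) * (x + y) ^ k)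
    ≈ const (fromℕ (2 ℕ.* m ∸ 1)) * (x + y) ^ (2 ℕ.* m) + (x - y) ^ (2 ℕ.* m) )
mainTheorem8 m m≥1 =
    odd-identity x y m (2 ℕ.* m) ≡.refl (ℕ.≤-trans (s≤s z≤n) 2m≥2)
  , even-identity x y m (2 ℕ.* m) ≡.refl 2m≥2
  where
  -- Ensures that `2m ∸ 1` and `2m ∸ 2` are true differences.
  2m≥2 : 2 ℕ.* m ≥ 2
  2m≥2 = ℕ.*-monoʳ-≤ 2 m≥1
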